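{- Let $G$ be an $n$-vertex graph. Then $G$ contains a relatively half-full subgraph with $\lfloor \frac{n}{2} \rfloor$ or $\lfloor \frac{n}{2} \rfloor + 1$ vertices.
   Context: Graphs are finite and simple. For a graph $G$, a relatively half-full subgraph of $G$ is a subgraph $H$ of $G$ such that $d_H(v) \geq \frac{1}{2} d_G(v)$ for every $v \in V(H)$, where $d_H(v)$ and $d_G(v)$ denote the degrees of $v$ in $H$ and $G$. (The empty subgraph on $0$ vertices satisfies this vacuously.) -}

module Defs where

open import Data.Fin.Base using (Fin)
open import Data.Fin.Subset using (Subset; _∈_; ∣_∣)
open import Data.Nat.Base using (ℕ; _*_; _≥_)
open import Data.Vec.Base using (tabulate)
open import Level using (0ℓ)
open import Relation.Binary.Core using (Rel; _⇒_)
open import Relation.Binary.Definitions using (Decidable; Irreflexive; Symmetric)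
open import Relation.Binary.PropositionalEquality.Core using (_≡_)
open import Relation.Nullary.Decidable.Core using (does)

-- Decidability of adjacency makes the edge set finite in the constructive
-- sense, so that degrees are natural numbers.
record Graph (n : ℕ) : Set₁ where
  field
    Adj    : Rel (Fin n) 0ℓ
    adj?   : Decidable Adj
    sym    : Symmetric Adj
    irrefl : Irreflexive _≡_ Adj

-- Subgraphs need not be induced: H may omit edges of G between its vertices.
record Subgraph {n : ℕ} (G : Graph n) : Set₁ where
  field
    vertices : Subset n
    Adj      : Rel (Fin n) 0ℓ
    adj?     : Decidable Adj
    sym      : Symmetric Adj
    Adj⇒∈    : ∀ {u v} → Adj u v → u ∈ vertices
    Adj⇒Adj  : Adj ⇒ Graph.Adj G

neighbours : ∀ {n} {_~_ : Rel (Fin n) 0ℓ} → Decidable _~_ → Fin n → Subset n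
neighbours _~?_ v = tabulate (λ w → does (v ~? w))

degree : ∀ {n} → Graph n → Fin n → ℕ
degree G v = ∣ neighbours (Graph.adj? G) v ∣

degreeIn : ∀ {n} {G : Graph n} → Subgraph G → Fin n → ℕ
degreeIn H v = ∣ neighbours (Subgraph.adj? H) v ∣

order : ∀ {n} {G : Graph n} → Subgraph G → ℕ
order H = ∣ Subgraph.vertices H ∣

-- The inequality d_H(v) ≥ ½ d_G(v), with the denominator cleared.
RelativelyHalfFull : ∀ {n} {G : Graph n} → Subgraph G → Set
RelativelyHalfFull {G = G} H =
  ∀ v → v ∈ Subgraph.vertices H → 2 * degreeIn H v ≥ degree G v

{-# OPTIONS --safe #-}
-- Among the vertex sets A of size ⌊ n /2⌋ choose one minimising the number of
-- edges leaving A.  If the complement of A is not half-full, some b outside A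
-- has more than half of its neighbours in A.  Then A + b is half-full: for
-- a ∈ A, exchanging a for b does not decrease the cut, and adding this
-- inequality to the one satisfied by b bounds the degree of a.
module Submission where

open import Data.Bool.Base using (Bool; true; false; _∧_)
open import Data.Fin.Base using (Fin; zero; suc)
open import Data.Fin.Properties using (any?; _≟_)
open import Data.Fin.Subset
  using (Subset; inside; outside; _∈_; _∉_; ∣_∣; ∁; ⊤; ⊥)
open import Data.Fin.Subset.Properties
  using (_∈?_; anySubset?; x∈∁p⇒x∉p; ∣⊥∣≡0; ∣∁p∣≡n∸∣p∣)
open import Data.Nat.Base
  using (ℕ; zero; suc; _+_; _*_; _∸_; _≤_; _<_; z≤n; s≤s; ⌊_/2⌋; ⌈_/2⌉)
open import Data.Nat.Induction using (Acc; acc; <-wellFounded)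
import Data.Nat.Properties as ℕ
open import Data.Nat.Tactic.RingSolver using (solve-∀)
open import Data.Product.Base using (Σ; ∃; _×_; _,_; proj₁; proj₂; map)
open import Data.Sum.Base as Sum using (_⊎_; inj₁; inj₂)
open import Data.Vec.Base using ([]; _∷_; here; there; lookup; tabulate; _[_]≔_)
open import Data.Vec.Properties
  using ([]=⇒lookup; lookup⇒[]=; lookup∘update; lookup∘update′; []≔-idempotent;
         []≔-lookup)
open import Function.Base using (_∘_; const)
open import Function.Bundles using (mk⇔)
open import Relation.Binary.PropositionalEquality
  using (_≡_; refl; sym; trans; cong; cong₂; subst; module ≡-Reasoning)
open import Relation.Nullary.Decidable
  using (yes; no; does; _×-dec_; dec-false; does-⇔)
open import Relation.Nullary.Negation using (contradiction)
open import Relation.Unary using (Pred; Decidable)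
open import Defs

private
  variable
    n : ℕ

-- Sums over subsets of `Fin n`

ι : Bool → ℕ
ι true  = 1
ι false = 0

∑∈ : Subset n → (Fin n → ℕ) → ℕ
∑∈ []            f = 0
∑∈ (inside  ∷ p) f = f zero + ∑∈ p (f ∘ suc)
∑∈ (outside ∷ p) f = ∑∈ p (f ∘ suc)

∑∈-cong : ∀ (p : Subset n) {f g} → (∀ i → f i ≡ g i) → ∑∈ p f ≡ ∑∈ p g
∑∈-cong []            f≗g = refl
∑∈-cong (inside  ∷ p) f≗g = cong₂ _+_ (f≗g zero) (∑∈-cong p (f≗g ∘ suc))
∑∈-cong (outside ∷ p) f≗g = ∑∈-cong p (f≗g ∘ suc)

∑∈-distrib-+ : ∀ (p : Subset n) f g →
               ∑∈ p (λ i → f i + g i) ≡ ∑∈ p f + ∑∈ p g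
∑∈-distrib-+ []            f g = refl
∑∈-distrib-+ (outside ∷ p) f g = ∑∈-distrib-+ p (f ∘ suc) (g ∘ suc)
∑∈-distrib-+ (inside  ∷ p) f g =
  trans (cong (f zero + g zero +_) (∑∈-distrib-+ p (f ∘ suc) (g ∘ suc)))
        (interchange (f zero) (g zero) (∑∈ p (f ∘ suc)) (∑∈ p (g ∘ suc)))
  where
  interchange : ∀ a b c d → a + b + (c + d) ≡ (a + c) + (b + d)
  interchange = solve-∀

∑∈-∁ : ∀ (p : Subset n) f → ∑∈ p f + ∑∈ (∁ p) f ≡ ∑∈ ⊤ f
∑∈-∁ []            f = refl
∑∈-∁ (inside  ∷ p) f =
  trans (ℕ.+-assoc (f zero) _ _) (cong (f zero +_) (∑∈-∁ p (f ∘ suc)))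
∑∈-∁ (outside ∷ p) f =
  trans (swap (∑∈ p (f ∘ suc)) (f zero) (∑∈ (∁ p) (f ∘ suc)))
        (cong (f zero +_) (∑∈-∁ p (f ∘ suc)))
  where
  swap : ∀ a b c → a + (b + c) ≡ b + (a + c)
  swap = solve-∀

∣p∣≡∑∈1 : ∀ (p : Subset n) → ∣ p ∣ ≡ ∑∈ p (const 1)
∣p∣≡∑∈1 []            = refl
∣p∣≡∑∈1 (inside  ∷ p) = cong suc (∣p∣≡∑∈1 p)
∣p∣≡∑∈1 (outside ∷ p) = ∣p∣≡∑∈1 p

-- Turns the cardinality that defines `degree` into a sum over all vertices, which `∑∈-∁` can split
-- along a vertex set.
∣tabulate∣≡∑∈⊤ : ∀ (g : Fin n → Bool) → ∣ tabulate g ∣ ≡ ∑∈ ⊤ (ι ∘ g)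
∣tabulate∣≡∑∈⊤ {zero}  g = refl
∣tabulate∣≡∑∈⊤ {suc n} g with g zero
... | true  = cong suc (∣tabulate∣≡∑∈⊤ (g ∘ suc))
... | false = ∣tabulate∣≡∑∈⊤ (g ∘ suc)

-- The conjunction is what adjacency in an induced subgraph evaluates to once its first endpoint is
-- known to lie in `p`.
∣tabulate-∈?-∧∣≡∑∈ : ∀ (p : Subset n) (g : Fin n → Bool) →
                     ∣ tabulate (λ i → does (i ∈? p) ∧ g i) ∣ ≡ ∑∈ p (ι ∘ g)
∣tabulate-∈?-∧∣≡∑∈ []            g = refl
∣tabulate-∈?-∧∣≡∑∈ (outside ∷ p) g = ∣tabulate-∈?-∧∣≡∑∈ p (g ∘ suc)
∣tabulate-∈?-∧∣≡∑∈ (inside  ∷ p) g with g zero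
... | true  = cong suc (∣tabulate-∈?-∧∣≡∑∈ p (g ∘ suc))
... | false = ∣tabulate-∈?-∧∣≡∑∈ p (g ∘ suc)

-- Inserting and deleting one vertex

insert delete : Fin n → Subset n → Subset n
insert v p = p [ v ]≔ inside
delete v p = p [ v ]≔ outside

x∈insert⁻ : ∀ {v w} (p : Subset n) → w ∈ insert v p → w ≡ v ⊎ w ∈ p
x∈insert⁻ {v = v} {w} p w∈ with w ≟ v
... | yes w≡v = inj₁ w≡v
... | no  w≢v = inj₂ (lookup⇒[]= w p
                  (trans (sym (lookup∘update′ w≢v p inside)) ([]=⇒lookup w∈)))

v∉delete : ∀ v (p : Subset n) → v ∉ delete v p
v∉delete v p v∈ with trans (sym (lookup∘update v p outside)) ([]=⇒lookup v∈)
... | ()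

∉-delete : ∀ {v w} (p : Subset n) → w ∉ p → w ∉ delete v p
∉-delete {v = v} {w} p w∉p w∈ with w ≟ v
... | yes refl = v∉delete v p w∈
... | no  w≢v  = w∉p (lookup⇒[]= w p
                   (trans (sym (lookup∘update′ w≢v p outside)) ([]=⇒lookup w∈)))

insert-delete : ∀ {v} (p : Subset n) → v ∈ p → insert v (delete v p) ≡ p
insert-delete {v = v} p v∈p = begin
  insert v (delete v p)    ≡⟨ []≔-idempotent p v ⟩
  p [ v ]≔ inside          ≡⟨ cong (p [ v ]≔_) ([]=⇒lookup v∈p) ⟨
  p [ v ]≔ lookup p v      ≡⟨ []≔-lookup p v ⟩
  p                        ∎
  where open ≡-Reasoning

-- Taken at the constant 1, at a row of the adjacency matrix, at `degree G` and at `degreeInto`, it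
-- describes how size, degrees, `volume` and `internal` change when a vertex is added.
∑∈-insert : ∀ (p : Subset n) {v} f → v ∉ p → ∑∈ (insert v p) f ≡ ∑∈ p f + f v
∑∈-insert (inside  ∷ p) {zero}  f v∉p = contradiction here v∉p
∑∈-insert (outside ∷ p) {zero}  f v∉p = ℕ.+-comm (f zero) _
∑∈-insert (outside ∷ p) {suc v} f v∉p = ∑∈-insert p (f ∘ suc) (v∉p ∘ there)
∑∈-insert (inside  ∷ p) {suc v} f v∉p =
  trans (cong (f zero +_) (∑∈-insert p (f ∘ suc) (v∉p ∘ there)))
        (sym (ℕ.+-assoc (f zero) _ _))

∣insert∣ : ∀ (p : Subset n) {v} → v ∉ p → ∣ insert v p ∣ ≡ ∣ p ∣ + 1
∣insert∣ p {v} v∉p = begin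
  ∣ insert v p ∣              ≡⟨ ∣p∣≡∑∈1 (insert v p) ⟩
  ∑∈ (insert v p) (const 1)   ≡⟨ ∑∈-insert p (const 1) v∉p ⟩
  ∑∈ p (const 1) + 1          ≡⟨ cong (_+ 1) (∣p∣≡∑∈1 p) ⟨
  ∣ p ∣ + 1                   ∎
  where open ≡-Reasoning

-- Extremal subsets and halves of `n`

subsetOfSize : ∀ {k} → k ≤ n → ∃ λ (p : Subset n) → ∣ p ∣ ≡ k
subsetOfSize {n}     z≤n       = ⊥ , ∣⊥∣≡0 n
subsetOfSize         (s≤s k≤n) = map (inside ∷_) (cong suc) (subsetOfSize k≤n)

-- Descent: an exhaustive search either finds a candidate with a smaller value of `f` or certifies
-- that the current one is minimal. It stops because `<` on the values is well-founded.
minimiser : ∀ {ℓ} {P : Pred (Subset n) ℓ} → Decidable P →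
            (f : Subset n → ℕ) → ∃ P →
            ∃ λ p → P p × (∀ q → P q → f p ≤ f q)
minimiser {P = P} P? f (p , Pp) = go p Pp (<-wellFounded (f p))
  where
  go : ∀ p → P p → Acc _<_ (f p) → ∃ λ p → P p × (∀ q → P q → f p ≤ f q)
  go p Pp (acc rs) with anySubset? (λ q → P? q ×-dec f q ℕ.<? f p)
  ... | yes (q , Pq , fq<fp) = go q Pq (rs fq<fp)
  ... | no  ∄smaller         =
    p , Pp , λ q Pq → ℕ.≮⇒≥ (λ fq<fp → ∄smaller (q , Pq , fq<fp))

-- The complement of a set of size `⌊ n /2⌋` has `⌈ n /2⌉` elements. The first alternative is the
-- even case, the second the odd one.
⌈n/2⌉≡⌊n/2⌋⊎⌊n/2⌋+1 : ∀ n → ⌈ n /2⌉ ≡ ⌊ n /2⌋ ⊎ ⌈ n /2⌉ ≡ ⌊ n /2⌋ + 1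
⌈n/2⌉≡⌊n/2⌋⊎⌊n/2⌋+1 zero          = inj₁ refl
⌈n/2⌉≡⌊n/2⌋⊎⌊n/2⌋+1 (suc zero)    = inj₂ refl
⌈n/2⌉≡⌊n/2⌋⊎⌊n/2⌋+1 (suc (suc n)) =
  Sum.map (cong suc) (cong suc) (⌈n/2⌉≡⌊n/2⌋⊎⌊n/2⌋+1 n)

n∸⌊n/2⌋≡⌈n/2⌉ : ∀ n → n ∸ ⌊ n /2⌋ ≡ ⌈ n /2⌉
n∸⌊n/2⌋≡⌈n/2⌉ n =
  trans (cong (_∸ ⌊ n /2⌋) (sym (ℕ.⌊n/2⌋+⌈n/2⌉≡n n)))
        (ℕ.m+n∸m≡n ⌊ n /2⌋ ⌈ n /2⌉)

-- Degrees into a vertex set and induced subgraphs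

module _ (G : Graph n) where
  open Graph G using (Adj; adj?)

  adjacency : Fin n → Fin n → ℕ
  adjacency u v = ι (does (adj? u v))

  adjacency-sym : ∀ u v → adjacency u v ≡ adjacency v u
  adjacency-sym u v =
    cong ι (does-⇔ (mk⇔ (Graph.sym G) (Graph.sym G)) (adj? u v) (adj? v u))

  adjacency-irrefl : ∀ v → adjacency v v ≡ 0
  adjacency-irrefl v = cong ι (dec-false (adj? v v) (Graph.irrefl G refl))

  degreeInto : Subset n → Fin n → ℕ
  degreeInto p v = ∑∈ p (adjacency v)

  degreeInto-∁ : ∀ p v → degreeInto p v + degreeInto (∁ p) v ≡ degree G v
  degreeInto-∁ p v =
    trans (∑∈-∁ p (adjacency v)) (sym (∣tabulate∣≡∑∈⊤ (λ w → does (adj? v w))))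

  degreeInto-insert-self : ∀ p {v} → v ∉ p →
                           degreeInto (insert v p) v ≡ degreeInto p v
  degreeInto-insert-self p {v} v∉p = begin
    degreeInto (insert v p) v           ≡⟨ ∑∈-insert p (adjacency v) v∉p ⟩
    degreeInto p v + adjacency v v      ≡⟨ cong (degreeInto p v +_) (adjacency-irrefl v) ⟩
    degreeInto p v + 0                  ≡⟨ ℕ.+-identityʳ _ ⟩
    degreeInto p v                      ∎
    where open ≡-Reasoning

  induced : Subset n → Subgraph G
  induced p = record
    { vertices = p
    ; Adj      = λ u v → u ∈ p × v ∈ p × Adj u v
    ; adj?     = λ u v → (u ∈? p) ×-dec (v ∈? p) ×-dec adj? u v
    ; sym      = λ (u∈p , v∈p , u~v) → v∈p , u∈p , Graph.sym G u~v
    ; Adj⇒∈    = proj₁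
    ; Adj⇒Adj  = proj₂ ∘ proj₂
    }

  degreeIn-induced : ∀ p {v} → v ∈ p → degreeIn (induced p) v ≡ degreeInto p v
  degreeIn-induced p {v} v∈p with v ∈? p
  ... | yes _   = ∣tabulate-∈?-∧∣≡∑∈ p (λ w → does (adj? v w))
  ... | no  v∉p = contradiction v∈p v∉p

  induced-halfFull : ∀ p → (∀ v → v ∈ p → degree G v ≤ 2 * degreeInto p v) →
                     RelativelyHalfFull (induced p)
  induced-halfFull p half v v∈p =
    subst (λ d → degree G v ≤ 2 * d) (sym (degreeIn-induced p v∈p)) (half v v∈p)

  -- Cuts and the exchange of two vertices

  volume internal cut : Subset n → ℕ
  volume   p = ∑∈ p (degree G)
  internal p = ∑∈ p (degreeInto p)
  cut      p = ∑∈ p (degreeInto (∁ p))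

  internal+cut≡volume : ∀ p → internal p + cut p ≡ volume p
  internal+cut≡volume p =
    trans (sym (∑∈-distrib-+ p (degreeInto p) (degreeInto (∁ p))))
          (∑∈-cong p (degreeInto-∁ p))

  -- `internal` counts every edge inside the set once from each end, so each new edge between `v`
  -- and `p` contributes 2.
  internal-insert : ∀ p {v} → v ∉ p →
                    internal (insert v p) ≡ internal p + 2 * degreeInto p v
  internal-insert p {v} v∉p = begin
    ∑∈ (insert v p) (degreeInto (insert v p))
      ≡⟨ ∑∈-insert p (degreeInto (insert v p)) v∉p ⟩
    ∑∈ p (degreeInto (insert v p)) + degreeInto (insert v p) v
      -- Each `u` gains `adjacency u v`; by symmetry these gains form the row of `v`, whose sum over
      -- `p` is again `degreeInto p v`.
      ≡⟨ cong₂ _+_ (∑∈-cong p step) (degreeInto-insert-self p v∉p) ⟩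
    ∑∈ p (λ u → degreeInto p u + adjacency v u) + degreeInto p v
      ≡⟨ cong (_+ degreeInto p v) (∑∈-distrib-+ p (degreeInto p) (adjacency v)) ⟩
    internal p + degreeInto p v + degreeInto p v
      ≡⟨ double (internal p) (degreeInto p v) ⟩
    internal p + 2 * degreeInto p v ∎
    where
    open ≡-Reasoning
    step : ∀ u → degreeInto (insert v p) u ≡ degreeInto p u + adjacency v u
    step u = trans (∑∈-insert p (adjacency u) v∉p)
                   (cong (degreeInto p u +_) (adjacency-sym u v))
    double : ∀ a b → a + b + b ≡ a + 2 * b
    double = solve-∀

  -- Adding `v` changes the cut by `degree G v` minus `2 * degreeInto p v`. The equation avoids
  -- subtraction by replacing `cut p` with `volume p` minus `internal p`.
  cut-insert : ∀ p {v} → v ∉ p →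
               internal p + 2 * degreeInto p v + cut (insert v p)
                 ≡ volume p + degree G v
  cut-insert p {v} v∉p = begin
    internal p + 2 * degreeInto p v + cut (insert v p)
      ≡⟨ cong (_+ cut (insert v p)) (internal-insert p v∉p) ⟨
    internal (insert v p) + cut (insert v p)  ≡⟨ internal+cut≡volume (insert v p) ⟩
    volume (insert v p)                       ≡⟨ ∑∈-insert p (degree G) v∉p ⟩
    volume p + degree G v                     ∎
    where open ≡-Reasoning

  -- By `cut-insert`, both cuts equal a quantity depending on `p` alone plus the degree of the added
  -- vertex minus twice its degree into `p`. Comparing them leaves only the terms of `a` and `b`.
  exchange : ∀ p {a b} → a ∉ p → b ∉ p → cut (insert a p) ≤ cut (insert b p) →
             degree G a + 2 * degreeInto p b ≤ degree G b + 2 * degreeInto p a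
  exchange p {a} {b} a∉p b∉p cut≤ = ℕ.+-cancelˡ-≤ (volume p) _ _ (begin
    volume p + (degree G a + 2 * degreeInto p b)
      ≡⟨ ℕ.+-assoc (volume p) _ _ ⟨
    volume p + degree G a + 2 * degreeInto p b
      ≡⟨ cong (_+ 2 * degreeInto p b) (cut-insert p a∉p) ⟨
    internal p + 2 * degreeInto p a + cut (insert a p) + 2 * degreeInto p b
      ≤⟨ ℕ.+-monoˡ-≤ (2 * degreeInto p b)
           (ℕ.+-monoʳ-≤ (internal p + 2 * degreeInto p a) cut≤) ⟩
    internal p + 2 * degreeInto p a + cut (insert b p) + 2 * degreeInto p b
      ≡⟨ rearrange (internal p) (2 * degreeInto p a)
           (cut (insert b p)) (2 * degreeInto p b) ⟩
    internal p + 2 * degreeInto p b + cut (insert b p) + 2 * degreeInto p a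
      ≡⟨ cong (_+ 2 * degreeInto p a) (cut-insert p b∉p) ⟩
    volume p + degree G b + 2 * degreeInto p a
      ≡⟨ ℕ.+-assoc (volume p) _ _ ⟩
    volume p + (degree G b + 2 * degreeInto p a) ∎)
    where
    open ℕ.≤-Reasoning
    rearrange : ∀ i x c y → i + x + c + y ≡ i + y + c + x
    rearrange = solve-∀

  -- Here `insert a p` is the minimising set. In the sum of the exchange inequality and the bound
  -- for `b`, the terms `degree G b` and `2 * degreeInto p b` cancel.
  degree≤-after-exchange : ∀ p {a b} → a ∉ p → b ∉ insert a p → b ∉ p →
    cut (insert a p) ≤ cut (insert b p) →
    degree G b ≤ 2 * degreeInto (insert a p) b →
    degree G a ≤ 2 * degreeInto (insert b (insert a p)) a
  degree≤-after-exchange p {a} {b} a∉p b∉p+a b∉p cut≤ deg-b≤ =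
    ℕ.+-cancelʳ-≤ (2 * degreeInto p b) _ _ (begin
      degree G a + 2 * degreeInto p b
        ≤⟨ exchange p a∉p b∉p cut≤ ⟩
      degree G b + 2 * degreeInto p a
        ≤⟨ ℕ.+-monoˡ-≤ (2 * degreeInto p a) deg-b≤ ⟩
      2 * degreeInto (insert a p) b + 2 * degreeInto p a
        ≡⟨ cong (λ d → 2 * d + 2 * degreeInto p a) (∑∈-insert p (adjacency b) a∉p) ⟩
      2 * (degreeInto p b + adjacency b a) + 2 * degreeInto p a
        -- The possible edge between `a` and `b` passes from the count at `b` to the count at `a`,
        -- since each of them sees the other in the enlarged set.
        ≡⟨ rearrange (degreeInto p b) (adjacency b a) (degreeInto p a) ⟩
      2 * (degreeInto p a + adjacency b a) + 2 * degreeInto p b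
        ≡⟨ cong (λ d → 2 * d + 2 * degreeInto p b) deg-a ⟨
      2 * degreeInto (insert b (insert a p)) a + 2 * degreeInto p b ∎)
    where
    open ℕ.≤-Reasoning
    rearrange : ∀ x m y → 2 * (x + m) + 2 * y ≡ 2 * (y + m) + 2 * x
    rearrange = solve-∀
    deg-a : degreeInto (insert b (insert a p)) a ≡ degreeInto p a + adjacency b a
    deg-a = trans (∑∈-insert (insert a p) (adjacency a) b∉p+a)
                  (cong₂ _+_ (degreeInto-insert-self p a∉p) (adjacency-sym a b))

  module _ {A : Subset n} (minimal : ∀ B → ∣ B ∣ ≡ ∣ A ∣ → cut A ≤ cut B)
           {b : Fin n} (b∉A : b ∉ A) (deg-b≤ : degree G b ≤ 2 * degreeInto A b)
           where

    -- The vertex `b` keeps its degree into `A`, as it is not its own neighbour. For `v` in `A`,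
    -- removing `v` gives the common set `p` from which `A` and its competitor `insert b p` both
    -- arise by one insertion.
    insert-halfFull : ∀ v → v ∈ insert b A → degree G v ≤ 2 * degreeInto (insert b A) v
    insert-halfFull v v∈ with x∈insert⁻ A v∈
    ... | inj₁ refl =
      subst (λ d → degree G v ≤ 2 * d) (sym (degreeInto-insert-self A b∉A)) deg-b≤
    ... | inj₂ v∈A =
      subst (λ q → degree G v ≤ 2 * degreeInto (insert b q) v) p+v≡A
        (degree≤-after-exchange p v∉p
          (subst (b ∉_) (sym p+v≡A) b∉A) b∉p
          (subst (λ q → cut q ≤ cut (insert b p)) (sym p+v≡A)
            (minimal (insert b p) same-size))
          (subst (λ q → degree G b ≤ 2 * degreeInto q b) (sym p+v≡A) deg-b≤))
      where
      p : Subset n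
      p = delete v A
      p+v≡A : insert v p ≡ A
      p+v≡A = insert-delete A v∈A
      v∉p : v ∉ p
      v∉p = v∉delete v A
      b∉p : b ∉ p
      b∉p = ∉-delete A b∉A
      same-size : ∣ insert b p ∣ ≡ ∣ A ∣
      same-size = trans (∣insert∣ p b∉p) (trans (sym (∣insert∣ p v∉p)) (cong ∣_∣ p+v≡A))

  -- The degrees into `p` and into its complement add up to the whole degree, so at least half must
  -- fall in `p` when less than half falls outside.
  <half-∁⇒≤half : ∀ p {v} → 2 * degreeInto (∁ p) v < degree G v →
                  degree G v ≤ 2 * degreeInto p v
  <half-∁⇒≤half p {v} few = ℕ.+-cancelʳ-≤ (degree G v) _ _ (begin
    degree G v + degree G v
      ≡⟨ cong₂ _+_ (degreeInto-∁ p v) (degreeInto-∁ p v) ⟨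
    (degreeInto p v + degreeInto (∁ p) v) + (degreeInto p v + degreeInto (∁ p) v)
      ≡⟨ double (degreeInto p v) (degreeInto (∁ p) v) ⟩
    2 * degreeInto p v + 2 * degreeInto (∁ p) v
      ≤⟨ ℕ.+-monoʳ-≤ (2 * degreeInto p v) (ℕ.<⇒≤ few) ⟩
    2 * degreeInto p v + degree G v ∎)
    where
    open ℕ.≤-Reasoning
    double : ∀ x y → (x + y) + (x + y) ≡ 2 * x + 2 * y
    double = solve-∀

-- Choosing between the complement and the enlarged set

theorem5 : ∀ (n : ℕ) (G : Graph n) → Σ (Subgraph G) λ H →
    RelativelyHalfFull H × (order H ≡ ⌊ n /2⌋ ⊎ order H ≡ ⌊ n /2⌋ + 1)
theorem5 n G
  with minimiser (λ p → ∣ p ∣ ℕ.≟ ⌊ n /2⌋) (cut G) (subsetOfSize (ℕ.⌊n/2⌋≤n n))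
... | A , ∣A∣≡k , minimal
  -- Searches for a vertex at which the complement of `A` fails to be half-full.
  with any? (λ b → (b ∈? ∁ A) ×-dec (2 * degreeInto G (∁ A) b ℕ.<? degree G b))
... | no ∄bad =
  induced G (∁ A)
  , induced-halfFull G (∁ A) (λ v v∈ → ℕ.≮⇒≥ (λ few → ∄bad (v , v∈ , few)))
  , Sum.map (trans ∣∁A∣) (trans ∣∁A∣) (⌈n/2⌉≡⌊n/2⌋⊎⌊n/2⌋+1 n)
  where
  ∣∁A∣ : ∣ ∁ A ∣ ≡ ⌈ n /2⌉
  ∣∁A∣ = trans (∣∁p∣≡n∸∣p∣ A) (trans (cong (n ∸_) ∣A∣≡k) (n∸⌊n/2⌋≡⌈n/2⌉ n))
... | yes (b , b∈∁A , few) =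
  induced G (insert b A)
  , induced-halfFull G (insert b A)
      -- Minimality is known among sets of size `⌊ n /2⌋`, and `A` itself has that size.
      (insert-halfFull G (λ B ∣B∣≡∣A∣ → minimal B (trans ∣B∣≡∣A∣ ∣A∣≡k))
        b∉A (<half-∁⇒≤half G A few))
  , inj₂ (trans (∣insert∣ A b∉A) (cong (_+ 1) ∣A∣≡k))
  where
  b∉A : b ∉ A
  b∉A = x∈∁p⇒x∉p b∈∁A
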